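{- Let $(A,B)$ be a symmetric ideal degree-three Prouhet--Tarry--Escott solution with center $c\in\frac12\mathbb Z$. Then, after subtracting $c$ and multiplying all centered coordinates by $2$, one may write $$2(A-c)=\{\pm x,\pm y\},\qquad 2(B-c)=\{\pm u,\pm v\},$$ where $x,y,u,v\in\mathbb Z$ have the same parity. In these coordinates, $(A,B)$ is an ideal degree-three Prouhet--Tarry--Escott solution if and only if $$x^2+y^2=u^2+v^2.$$
   Context: Multisets are counted with multiplicity. A pair $(A,B)$ of four-element multisets of integers is an ideal degree-three Prouhet--Tarry--Escott solution if $\sum_{a\in A}a^\ell=\sum_{b\in B}b^\ell$ for $\ell=1,2,3$. An ideal degree-three Prouhet--Tarry--Escott solution $(A,B)$ is called symmetric if there exists $c\in\frac12\mathbb Z$ (its center) such that both centered multisets $A-c=\{a-c:a\in A\}$ and $B-c=\{b-c:b\in B\}$ are invariant under sign reversal $t\mapsto -t$ (as multisets); equivalently, its entries are paired by reflection about a common center. Here $2(A-c)=\{2(a-c):a\in A\}$, and similarly for $B$; the notation $\{\pm x,\pm y\}$ means the four-element multiset $\{x,-x,y,-y\}$. -}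

module Defs where

open import Data.Nat.Base using (ℕ)
import Data.Nat.Base as ℕ
open import Data.Integer.Base using (ℤ; +_; -_; _+_; _-_; _^_; 0ℤ)
open import Data.Integer.Divisibility using (_∣_)
open import Data.Rational.Base using (ℚ; _/_)
import Data.Rational.Base as ℚ
open import Data.Rational.Literals using (fromℤ)
open import Data.Vec.Base using (Vec; []; _∷_; map; foldr′; toList)
open import Data.List.Relation.Binary.Permutation.Propositional using (_↭_)
open import Data.Product.Base using (_×_; ∃-syntax)
open import Relation.Binary.PropositionalEquality.Core using (_≡_)

-- An n-element multiset is represented by an enumeration with multiplicity;
-- two enumerations denote the same multiset when one permutes the other (_≈ₘ_).
Multiset : Set → ℕ → Set
Multiset X n = Vec X n

infix 4 _≈ₘ_

_≈ₘ_ : ∀ {X : Set} {n} → Multiset X n → Multiset X n → Set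
A ≈ₘ B = toList A ↭ toList B

powerSum : ∀ {n} → ℕ → Multiset ℤ n → ℤ
powerSum ℓ A = foldr′ _+_ 0ℤ (map (_^ ℓ) A)

-- Trivial solutions, with A ≈ₘ B, are not excluded.
IsIdealPTE₃ : Multiset ℤ 4 → Multiset ℤ 4 → Set
IsIdealPTE₃ A B = ∀ ℓ → 1 ℕ.≤ ℓ → ℓ ℕ.≤ 3 → powerSum ℓ A ≡ powerSum ℓ B

IsHalfInteger : ℚ → Set
IsHalfInteger c = ∃[ k ] c ≡ k / 2

infixl 6 _⊖_

_⊖_ : ∀ {n} → Multiset ℤ n → ℚ → Multiset ℚ n
A ⊖ c = map (λ a → fromℤ a ℚ.- c) A

doubled : ∀ {n} → Multiset ℚ n → Multiset ℚ n
doubled = map (fromℤ (+ 2) ℚ.*_)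

SignInvariant : ∀ {n} → Multiset ℚ n → Set
SignInvariant S = map ℚ.-_ S ≈ₘ S

record IsSymmetricWithCenter (A B : Multiset ℤ 4) (c : ℚ) : Set where
  field
    isIdealPTE₃    : IsIdealPTE₃ A B
    isHalfInteger  : IsHalfInteger c
    signInvariantˡ : SignInvariant (A ⊖ c)
    signInvariantʳ : SignInvariant (B ⊖ c)

plusMinus : ℤ → ℤ → Multiset ℤ 4
plusMinus x y = x ∷ - x ∷ y ∷ - y ∷ []

SameParity : ℤ → ℤ → Set
SameParity x y = + 2 ∣ x - y

-- Does not presuppose that (A , B) is a Prouhet–Tarry–Escott solution.
record HasCoordinates (A B : Multiset ℤ 4) (c : ℚ) (x y u v : ℤ) : Set where
  field
    coordinatesˡ : doubled (A ⊖ c) ≈ₘ map fromℤ (plusMinus x y)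
    coordinatesʳ : doubled (B ⊖ c) ≈ₘ map fromℤ (plusMinus u v)
    sameParity   : SameParity x y × SameParity x u × SameParity x v

{-# OPTIONS --safe #-}

-- With c = k/2, the doubled centred entries are the integers 2a - k, all
-- congruent to k modulo 2.  A sign-invariant list of even length splits into
-- pairs {t, -t}, which gives the coordinates.  Being an ideal solution is
-- invariant under a ↦ 2a - k, and for {±x, ±y} the power sums of degree
-- 1, 2, 3 are 0, 2(x² + y²), 0.
module Submission where

open import Defs
open import Data.Integer.Base using (ℤ; _+_; _^_)
open import Data.Rational.Base using (ℚ)
open import Data.Product.Base using (_×_; ∃-syntax)
open import Function.Bundles using (_⇔_)
open import Relation.Binary.PropositionalEquality.Core using (_≡_)

open import Algebra.Properties.AbelianGroup using (∙-cancelʳ)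
open import Data.Integer.Base using (+_; -[1+_]; -_; _-_; _*_; 0ℤ; 1ℤ)
import Data.Integer.Properties as ℤ
open import Data.Integer.Divisibility.Signed using (_∣_; divides; ∣⇒∣ᵤ; ∣m∣n⇒∣m-n)
open import Data.Integer.Solver using (module +-*-Solver)
open import Data.Integer.Tactic.RingSolver using (solve-∀)
open import Data.List.Base as List using (List; []; _∷_; _++_; length)
open import Data.List.Membership.Propositional.Properties using (∈-∃++; ∈-map⁺)
open import Data.List.Relation.Binary.Permutation.Propositional
  using (_↭_; refl; prep; swap; ↭-refl; ↭-sym; ↭-trans; ↭⇒↭ₛ; module PermutationReasoning)
open import Data.List.Relation.Binary.Permutation.Propositional.Properties
  using (∈-resp-↭; All-resp-↭; ↭-length; shift; drop-∷) renaming (map⁺ to ↭-map⁺)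
open import Data.List.Relation.Binary.Permutation.Setoid.Properties using (foldr-commMonoid)
import Data.List.Relation.Unary.All as All
open import Data.List.Relation.Unary.Any using (here; there)
open import Data.Nat.Base as ℕ using (ℕ; suc; z≤n; s≤s)
import Data.Nat.Properties as ℕ
open import Data.Product.Base using (_,_)
import Data.Rational.Base as ℚ
open import Data.Rational.Literals using (fromℤ)
import Data.Rational.Properties as ℚ
import Data.Rational.Unnormalised.Base as ℚᵘ
import Data.Rational.Unnormalised.Properties as ℚᵘ
open import Data.Sum.Base using (_⊎_; inj₁; inj₂)
open import Data.Vec.Base using (Vec; []; _∷_; map; toList)
open import Data.Vec.Properties using (toList-map; map-∘; map-id; map-cong; length-toList)
import Data.Vec.Relation.Unary.All as VecAll
import Data.Vec.Relation.Unary.All.Properties as VecAll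
open import Function.Bundles using (mk⇔; module Equivalence)
open import Function.Construct.Composition using (_⇔-∘_)
open import Relation.Binary.PropositionalEquality
  using (refl; sym; trans; cong; cong₂; subst; subst₂; setoid; module ≡-Reasoning)

-- Sign-invariant lists

-- On a two-element list this reduces to `toList (plusMinus x y)`, which is what `bySize` relies on.
plusMinuses : List ℤ → List ℤ
plusMinuses []       = []
plusMinuses (y ∷ ys) = y ∷ - y ∷ plusMinuses ys

i≡-i⇒i≡0 : ∀ i → i ≡ - i → i ≡ 0ℤ
i≡-i⇒i≡0 (+ 0) _ = refl

-- The second alternative lets an unpaired zero wait for another one.
signInvariant⇒paired : ∀ n xs → length xs ℕ.≤ n → List.map -_ xs ↭ xs →
  ∃[ ys ] (xs ↭ plusMinuses ys ⊎ xs ↭ 0ℤ ∷ plusMinuses ys)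
signInvariant⇒paired _       []       _         _   = [] , inj₁ ↭-refl
-- The length bound `n` carries the recursion, because `as ++ bs` below is not a structural part of
-- the input.
signInvariant⇒paired (suc n) (x ∷ xs) (s≤s len) inv
  with ∈-resp-↭ inv (∈-map⁺ -_ (here refl))
-- If `- x` is found at the head then `x` is its own negative, hence zero, and cancels from both
-- sides of `inv`.
... | here -x≡x with refl ← i≡-i⇒i≡0 x (sym -x≡x) =
  case-tail (signInvariant⇒paired n xs len (drop-∷ inv))
  where
  case-tail : ∃[ ys ] (xs ↭ plusMinuses ys ⊎ xs ↭ 0ℤ ∷ plusMinuses ys) →
    ∃[ ys ] (0ℤ ∷ xs ↭ plusMinuses ys ⊎ 0ℤ ∷ xs ↭ 0ℤ ∷ plusMinuses ys)
  case-tail (ys , inj₁ p) = ys , inj₂ (prep _ p)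
  -- The new zero pairs with the one left over, since `- 0ℤ` computes to `0ℤ`.
  case-tail (ys , inj₂ p) = 0ℤ ∷ ys , inj₁ (prep _ p)
... | there -x∈xs with as , bs , refl ← ∈-∃++ -x∈xs =
  case-rest (signInvariant⇒paired n rest rest-len rest-inv)
  where
  rest = as ++ bs

  split : x ∷ as ++ List.[ - x ] ++ bs ↭ x ∷ - x ∷ rest
  split = prep x (shift (- x) as bs)

  rest-len : length rest ℕ.≤ n
  rest-len = ℕ.≤-trans (ℕ.n≤1+n _)
    (subst (ℕ._≤ n) (↭-length (shift (- x) as bs)) len)

  rest-inv : List.map -_ rest ↭ rest
  -- Negation merely exchanges `x` and `- x`, so both cancel from the invariance of the whole list.
  rest-inv = drop-∷ (drop-∷ (begin
    x ∷ - x ∷ List.map -_ rest              ↭⟨ swap x (- x) refl ⟩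
    - x ∷ x ∷ List.map -_ rest              ≡⟨ cong (λ t → - x ∷ t ∷ _) (sym (ℤ.neg-involutive x)) ⟩
    List.map -_ (x ∷ - x ∷ rest)            ↭⟨ ↭-map⁺ -_ split ⟨
    List.map -_ (x ∷ as ++ List.[ - x ] ++ bs) ↭⟨ inv ⟩
    x ∷ as ++ List.[ - x ] ++ bs            ↭⟨ split ⟩
    x ∷ - x ∷ rest                          ∎))
    where open PermutationReasoning

  case-rest : ∃[ ys ] (rest ↭ plusMinuses ys ⊎ rest ↭ 0ℤ ∷ plusMinuses ys) →
    ∃[ ys ] (x ∷ as ++ List.[ - x ] ++ bs ↭ plusMinuses ys
           ⊎ x ∷ as ++ List.[ - x ] ++ bs ↭ 0ℤ ∷ plusMinuses ys)
  case-rest (ys , inj₁ p) = x ∷ ys , inj₁ (↭-trans split (prep _ (prep _ p)))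
  case-rest (ys , inj₂ p) = x ∷ ys , inj₂ (begin
    x ∷ as ++ List.[ - x ] ++ bs    ↭⟨ split ⟩
    x ∷ - x ∷ rest                  ↭⟨ prep _ (prep _ p) ⟩
    x ∷ - x ∷ 0ℤ ∷ plusMinuses ys   ↭⟨ shift 0ℤ (x ∷ - x ∷ []) (plusMinuses ys) ⟩
    0ℤ ∷ x ∷ - x ∷ plusMinuses ys   ∎)
    where open PermutationReasoning

-- A leftover zero would make the length odd, so length four forces exactly two pairs.
signInvariant⇒plusMinus : (T : Multiset ℤ 4) → map -_ T ≈ₘ T → ∃[ x ] ∃[ y ] T ≈ₘ plusMinus x y
signInvariant⇒plusMinus T inv
  with signInvariant⇒paired 4 (toList T) (ℕ.≤-reflexive (length-toList T))
         (subst (_↭ toList T) (toList-map -_ T) inv)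
... | ys , p = bySize ys p
  where
  size : ∀ {zs} → toList T ↭ zs → 4 ≡ length zs
  size p = trans (sym (length-toList T)) (↭-length p)

  bySize : ∀ ys → (toList T ↭ plusMinuses ys ⊎ toList T ↭ 0ℤ ∷ plusMinuses ys) →
    ∃[ x ] ∃[ y ] T ≈ₘ plusMinus x y
  bySize (x ∷ y ∷ [])    (inj₁ p) = x , y , p
  bySize []              (inj₁ p) with () ← size p
  bySize (_ ∷ [])        (inj₁ p) with () ← size p
  bySize (_ ∷ _ ∷ _ ∷ _) (inj₁ p) with () ← size p
  bySize []              (inj₂ p) with () ← size p
  bySize (_ ∷ [])        (inj₂ p) with () ← size p
  bySize (_ ∷ _ ∷ _)     (inj₂ p) with () ← size p

-- Integer coordinates

map-≈ₘ : ∀ {X Y : Set} {n} (f : X → Y) {S T : Multiset X n} → S ≈ₘ T → map f S ≈ₘ map f T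
map-≈ₘ f {S} {T} p = subst₂ _↭_ (sym (toList-map f S)) (sym (toList-map f T)) (↭-map⁺ f p)

-- The numerator is a left inverse of `fromℤ`, and mapping it over both sides preserves the
-- permutation.
fromℤ-cancel-≈ₘ : ∀ {n} {S T : Multiset ℤ n} → map fromℤ S ≈ₘ map fromℤ T → S ≈ₘ T
fromℤ-cancel-≈ₘ {S = S} {T} p = subst₂ _≈ₘ_ (retract S) (retract T) (map-≈ₘ ℚ.↥_ p)
  where
  retract : ∀ {n} (S : Multiset ℤ n) → map ℚ.↥_ (map fromℤ S) ≡ S
  retract S = trans (sym (map-∘ ℚ.↥_ fromℤ S)) (map-id S)

fromℤ-neg : ∀ i → ℚ.- fromℤ i ≡ fromℤ (- i)
fromℤ-neg (+ 0)      = refl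
fromℤ-neg (+ suc _)  = refl
fromℤ-neg (-[1+ _ ]) = refl

double-centre : ℤ → ℤ → ℤ
double-centre k a = + 2 * a - k

-- The reduced form of k/2 depends on a gcd, so the identity is checked on unnormalised fractions,
-- where it becomes a polynomial identity after cross-multiplication.
fromℤ-double-centre : ∀ k a → fromℤ (+ 2) ℚ.* (fromℤ a ℚ.- k ℚ./ 2) ≡ fromℤ (double-centre k a)
fromℤ-double-centre k a = ℚ.toℚᵘ-injective (begin
  ℚ.toℚᵘ (fromℤ (+ 2) ℚ.* (fromℤ a ℚ.- k ℚ./ 2))
    ≈⟨ ℚ.toℚᵘ-homo-* (fromℤ (+ 2)) (fromℤ a ℚ.- k ℚ./ 2) ⟩
  two ℚᵘ.* ℚ.toℚᵘ (fromℤ a ℚ.- k ℚ./ 2)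
    ≈⟨ ℚᵘ.*-congˡ {two} (ℚ.toℚᵘ-homo-+ (fromℤ a) (ℚ.- (k ℚ./ 2))) ⟩
  two ℚᵘ.* (ℚᵘ.mkℚᵘ a 0 ℚᵘ.+ ℚ.toℚᵘ (ℚ.- (k ℚ./ 2)))
    ≈⟨ ℚᵘ.*-congˡ {two} (ℚᵘ.+-congʳ (ℚᵘ.mkℚᵘ a 0) (ℚ.toℚᵘ-homo‿- (k ℚ./ 2))) ⟩
  two ℚᵘ.* (ℚᵘ.mkℚᵘ a 0 ℚᵘ.- ℚ.toℚᵘ (k ℚ./ 2))
    -- `mkℚᵘ` stores the denominator minus one, so `mkℚᵘ k 1` is the unreduced k/2.
    ≈⟨ ℚᵘ.*-congˡ {two} (ℚᵘ.+-congʳ (ℚᵘ.mkℚᵘ a 0) (ℚᵘ.-‿cong (ℚ.toℚᵘ-fromℚᵘ (ℚᵘ.mkℚᵘ k 1)))) ⟩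
  two ℚᵘ.* (ℚᵘ.mkℚᵘ a 0 ℚᵘ.- ℚᵘ.mkℚᵘ k 1)
    ≈⟨ ℚᵘ.*≡* (cross-multiplied k a) ⟩
  ℚᵘ.mkℚᵘ (double-centre k a) 0 ∎)
  where
  open import Relation.Binary.Reasoning.Setoid ℚᵘ.≃-setoid
  two = ℚᵘ.mkℚᵘ (+ 2) 0

  cross-multiplied : ∀ k a → + 2 * (a * + 2 + - k * + 1) * + 1 ≡ (+ 2 * a - k) * + 2
  cross-multiplied = solve-∀

doubled-⊖ : ∀ {n} k (A : Multiset ℤ n) →
  doubled (A ⊖ (k ℚ./ 2)) ≡ map fromℤ (map (double-centre k) A)
doubled-⊖ k A = begin
  doubled (A ⊖ (k ℚ./ 2))                                    ≡⟨ map-∘ _ _ A ⟨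
  map (λ a → fromℤ (+ 2) ℚ.* (fromℤ a ℚ.- k ℚ./ 2)) A      ≡⟨ map-cong (fromℤ-double-centre k) A ⟩
  map (λ a → fromℤ (double-centre k a)) A                    ≡⟨ map-∘ _ _ A ⟩
  map fromℤ (map (double-centre k) A)                        ∎
  where open ≡-Reasoning

-- Doubling and `fromℤ` both commute with negation, so the symmetry passes from the centred
-- rationals to the integers 2a - k.
signInvariant-double-centre : ∀ {n} k (A : Multiset ℤ n) → SignInvariant (A ⊖ (k ℚ./ 2)) →
  map -_ (map (double-centre k) A) ≈ₘ map (double-centre k) A
signInvariant-double-centre k A inv =
  fromℤ-cancel-≈ₘ (subst₂ _≈ₘ_ doubled-neg (doubled-⊖ k A) (map-≈ₘ (fromℤ (+ 2) ℚ.*_) inv))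
  where
  open ≡-Reasoning
  S = A ⊖ (k ℚ./ 2)
  T = map (double-centre k) A

  doubled-neg : doubled (map ℚ.-_ S) ≡ map fromℤ (map -_ T)
  doubled-neg = begin
    doubled (map ℚ.-_ S)                    ≡⟨ map-∘ _ _ S ⟨
    map (λ s → fromℤ (+ 2) ℚ.* ℚ.- s) S    ≡⟨ map-cong (ℚ.neg-distribʳ-* (fromℤ (+ 2))) S ⟨
    map (λ s → ℚ.- (fromℤ (+ 2) ℚ.* s)) S  ≡⟨ map-∘ _ _ S ⟩
    map ℚ.-_ (doubled S)                    ≡⟨ cong (map (ℚ.-_)) (doubled-⊖ k A) ⟩
    map ℚ.-_ (map fromℤ T)                  ≡⟨ map-∘ _ _ T ⟨
    map (λ t → ℚ.- fromℤ t) T               ≡⟨ map-cong fromℤ-neg T ⟩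
    map (λ t → fromℤ (- t)) T               ≡⟨ map-∘ _ _ T ⟩
    map fromℤ (map -_ T)                    ∎

coordinates : ∀ k (A : Multiset ℤ 4) → SignInvariant (A ⊖ (k ℚ./ 2)) →
  ∃[ x ] ∃[ y ] map (double-centre k) A ≈ₘ plusMinus x y
coordinates k A inv =
  signInvariant⇒plusMinus (map (double-centre k) A) (signInvariant-double-centre k A inv)

double-centre-parity : ∀ k a → + 2 ∣ double-centre k a + k
double-centre-parity k a = divides a (lemma k a)
  where
  lemma : ∀ k a → + 2 * a - k + k ≡ a * + 2
  lemma = solve-∀

-- Each 2a - k becomes even on adding k, and a property of all entries survives permutation.
coordinates-parity : ∀ k (A : Multiset ℤ 4) {x y} → map (double-centre k) A ≈ₘ plusMinus x y →
  (+ 2 ∣ x + k) × (+ 2 ∣ y + k)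
coordinates-parity k A p
  with px All.∷ _ All.∷ py All.∷ _ ← All-resp-↭ {P = λ t → + 2 ∣ t + k} p
         (VecAll.toList⁺ (VecAll.map⁺ (VecAll.universal (double-centre-parity k) A)))
  = px , py

sameParity-by-shift : ∀ k x y → + 2 ∣ x + k → + 2 ∣ y + k → SameParity x y
sameParity-by-shift k x y p q = ∣⇒∣ᵤ (subst (+ 2 ∣_) (lemma k x y) (∣m∣n⇒∣m-n p q))
  where
  lemma : ∀ k x y → x + k - (y + k) ≡ x - y
  lemma = solve-∀

symmetric⇒coordinates : ∀ A B c → IsSymmetricWithCenter A B c →
  ∃[ x ] ∃[ y ] ∃[ u ] ∃[ v ] HasCoordinates A B c x y u v
-- One `k` serves both multisets, so parities relative to it can be compared between `A` and `B`.
symmetric⇒coordinates A B c record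
  { isHalfInteger = k , refl ; signInvariantˡ = invˡ ; signInvariantʳ = invʳ }
  with x , y , p ← coordinates k A invˡ
     | u , v , q ← coordinates k B invʳ
  with x-par , y-par ← coordinates-parity k A p
     | u-par , v-par ← coordinates-parity k B q
  = x , y , u , v , record
  { coordinatesˡ = subst (_≈ₘ map fromℤ (plusMinus x y)) (sym (doubled-⊖ k A)) (map-≈ₘ fromℤ p)
  ; coordinatesʳ = subst (_≈ₘ map fromℤ (plusMinus u v)) (sym (doubled-⊖ k B)) (map-≈ₘ fromℤ q)
  ; sameParity   = sameParity-by-shift k x y x-par y-par
                 , sameParity-by-shift k x u x-par u-par
                 , sameParity-by-shift k x v x-par v-par
  }

-- Power sums

-- Addition is commutative and associative, so the fold does not see the order of the entries.
powerSum-cong : ∀ {n} ℓ {S T : Multiset ℤ n} → S ≈ₘ T → powerSum ℓ S ≡ powerSum ℓ T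
powerSum-cong ℓ {S} {T} p = begin
  powerSum ℓ S                                        ≡⟨ asList S ⟩
  List.foldr _+_ 0ℤ (List.map (_^ ℓ) (toList S))
    ≡⟨ foldr-commMonoid (setoid ℤ) ℤ.+-0-isCommutativeMonoid (↭⇒↭ₛ (↭-map⁺ (_^ ℓ) p)) ⟩
  List.foldr _+_ 0ℤ (List.map (_^ ℓ) (toList T))      ≡⟨ asList T ⟨
  powerSum ℓ T                                        ∎
  where
  open ≡-Reasoning
  asList : ∀ {n} (S : Multiset ℤ n) → powerSum ℓ S ≡ List.foldr _+_ 0ℤ (List.map (_^ ℓ) (toList S))
  asList []      = refl
  asList (a ∷ S) = cong (_+_ (a ^ ℓ)) (asList S)

IsIdealPTE₃-resp-≈ₘ : ∀ {A A′ B B′} → A ≈ₘ A′ → B ≈ₘ B′ → IsIdealPTE₃ A B → IsIdealPTE₃ A′ B′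
IsIdealPTE₃-resp-≈ₘ p q pte ℓ 1≤ℓ ℓ≤3 =
  trans (sym (powerSum-cong ℓ p)) (trans (pte ℓ 1≤ℓ ℓ≤3) (powerSum-cong ℓ q))

IsIdealPTE₃⇔ : ∀ A B → IsIdealPTE₃ A B ⇔
  (powerSum 1 A ≡ powerSum 1 B × powerSum 2 A ≡ powerSum 2 B × powerSum 3 A ≡ powerSum 3 B)
IsIdealPTE₃⇔ A B = mk⇔
  (λ pte → pte 1 (s≤s z≤n) (s≤s z≤n)
         , pte 2 (s≤s z≤n) (s≤s (s≤s z≤n))
         , pte 3 (s≤s z≤n) (s≤s (s≤s (s≤s z≤n))))
  λ where
    (e₁ , e₂ , e₃) 1 _ _ → e₁
    (e₁ , e₂ , e₃) 2 _ _ → e₂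
    (e₁ , e₂ , e₃) 3 _ _ → e₃
    _ (suc (suc (suc (suc _)))) _ (s≤s (s≤s (s≤s ())))

module _ where
  open +-*-Solver

  private
    -- These mirror the recursion of `_^_` and `powerSum` in solver syntax, so that the solved
    -- equations evaluate to the stated ones.
    pow : ∀ {n} → Polynomial n → ℕ → Polynomial n
    pow p 0       = con 1ℤ
    pow p (suc ℓ) = p :* pow p ℓ

    Σpow : ∀ {n m} → ℕ → Vec (Polynomial n) m → Polynomial n
    Σpow ℓ []       = con 0ℤ
    Σpow ℓ (p ∷ ps) = pow p ℓ :+ Σpow ℓ ps

    :double-centre : ∀ {n} → Polynomial n → Polynomial n → Polynomial n
    :double-centre k p = con (+ 2) :* p :- k

    :plusMinus : ∀ {n} → Polynomial n → Polynomial n → Vec (Polynomial n) 4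
    :plusMinus x y = x ∷ :- x ∷ y ∷ :- y ∷ []

  -- Expanding (2a - k)^ℓ, here and in the next two lemmas, gives 2^ℓ times the sum of degree ℓ plus
  -- a remainder in `k` and the sums of lower positive degree. The pure power of `k` has coefficient
  -- 4 up to sign, one for each entry.
  powerSum₁-double-centre : ∀ k (A : Multiset ℤ 4) →
    powerSum 1 (map (double-centre k) A) ≡ + 2 * powerSum 1 A + - + 4 * k
  powerSum₁-double-centre k (a ∷ b ∷ c ∷ d ∷ []) = solve 5 (λ k a b c d →
    let A = a ∷ b ∷ c ∷ d ∷ [] in
    Σpow 1 (map (:double-centre k) A) := con (+ 2) :* Σpow 1 A :+ con (- + 4) :* k)
    refl k a b c d

  powerSum₂-double-centre : ∀ k (A : Multiset ℤ 4) →
    powerSum 2 (map (double-centre k) A) ≡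
    + 4 * powerSum 2 A + (- + 4 * k * powerSum 1 A + + 4 * k * k)
  powerSum₂-double-centre k (a ∷ b ∷ c ∷ d ∷ []) = solve 5 (λ k a b c d →
    let A = a ∷ b ∷ c ∷ d ∷ [] in
    Σpow 2 (map (:double-centre k) A) :=
    con (+ 4) :* Σpow 2 A :+ (con (- + 4) :* k :* Σpow 1 A :+ con (+ 4) :* k :* k))
    refl k a b c d

  powerSum₃-double-centre : ∀ k (A : Multiset ℤ 4) →
    powerSum 3 (map (double-centre k) A) ≡
    + 8 * powerSum 3 A +
    (- + 12 * k * powerSum 2 A + + 6 * k * k * powerSum 1 A + - + 4 * k * k * k)
  powerSum₃-double-centre k (a ∷ b ∷ c ∷ d ∷ []) = solve 5 (λ k a b c d →
    let A = a ∷ b ∷ c ∷ d ∷ [] in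
    Σpow 3 (map (:double-centre k) A) :=
    con (+ 8) :* Σpow 3 A :+
    (con (- + 12) :* k :* Σpow 2 A :+ con (+ 6) :* k :* k :* Σpow 1 A :+ con (- + 4) :* k :* k :* k))
    refl k a b c d

  powerSum₁-plusMinus : ∀ x y → powerSum 1 (plusMinus x y) ≡ 0ℤ
  powerSum₁-plusMinus = solve 2 (λ x y → Σpow 1 (:plusMinus x y) := con 0ℤ) refl

  powerSum₂-plusMinus : ∀ x y → powerSum 2 (plusMinus x y) ≡ + 2 * (x ^ 2 + y ^ 2)
  powerSum₂-plusMinus = solve 2 (λ x y →
    Σpow 2 (:plusMinus x y) := con (+ 2) :* (pow x 2 :+ pow y 2)) refl

  powerSum₃-plusMinus : ∀ x y → powerSum 3 (plusMinus x y) ≡ 0ℤ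
  powerSum₃-plusMinus = solve 2 (λ x y → Σpow 3 (:plusMinus x y) := con 0ℤ) refl

-- The expansions form a triangular system with leading coefficients 2, 4, 8. Equalities transfer
-- degree by degree, and in the reverse direction these nonzero coefficients cancel.
IsIdealPTE₃-double-centre : ∀ k A B →
  IsIdealPTE₃ A B ⇔ IsIdealPTE₃ (map (double-centre k) A) (map (double-centre k) B)
IsIdealPTE₃-double-centre k A B = mk⇔
  (λ pte → Equivalence.from (IsIdealPTE₃⇔ A′ B′) (to (Equivalence.to (IsIdealPTE₃⇔ A B) pte)))
  (λ pte → Equivalence.from (IsIdealPTE₃⇔ A B) (from (Equivalence.to (IsIdealPTE₃⇔ A′ B′) pte)))
  where
  A′ = map (double-centre k) A
  B′ = map (double-centre k) B

  -- The remainders as functions of the lower power sums, so that `cong` yields their equality from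
  -- the lower degrees.
  r₂ : ℤ → ℤ
  r₂ p₁ = - + 4 * k * p₁ + + 4 * k * k

  r₃ : ℤ → ℤ → ℤ
  r₃ p₁ p₂ = - + 12 * k * p₂ + + 6 * k * k * p₁ + - + 4 * k * k * k

  to : powerSum 1 A ≡ powerSum 1 B × powerSum 2 A ≡ powerSum 2 B × powerSum 3 A ≡ powerSum 3 B →
    powerSum 1 A′ ≡ powerSum 1 B′ × powerSum 2 A′ ≡ powerSum 2 B′ × powerSum 3 A′ ≡ powerSum 3 B′
  to (e₁ , e₂ , e₃) =
      extend 2 (powerSum₁-double-centre k A) (powerSum₁-double-centre k B) e₁ refl
    , extend 4 (powerSum₂-double-centre k A) (powerSum₂-double-centre k B) e₂ (cong r₂ e₁)
    , extend 8 (powerSum₃-double-centre k A) (powerSum₃-double-centre k B) e₃ (cong₂ r₃ e₁ e₂)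
    where
    extend : ∀ m {a b p q r s : ℤ} → a ≡ + m * p + r → b ≡ + m * q + s → p ≡ q → r ≡ s → a ≡ b
    extend m a≡ b≡ refl refl = trans a≡ (sym b≡)

  from : powerSum 1 A′ ≡ powerSum 1 B′ × powerSum 2 A′ ≡ powerSum 2 B′ × powerSum 3 A′ ≡ powerSum 3 B′ →
    powerSum 1 A ≡ powerSum 1 B × powerSum 2 A ≡ powerSum 2 B × powerSum 3 A ≡ powerSum 3 B
  from (e₁′ , e₂′ , e₃′) = e₁ , e₂ , e₃
    where
    cancel : ∀ m .{{_ : ℕ.NonZero m}} {a b} p q {r s : ℤ} →
      a ≡ + m * p + r → b ≡ + m * q + s → a ≡ b → r ≡ s → p ≡ q
    -- The common remainder is removed first, then the factor, which is visibly nonzero as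
    -- `+ suc m`.
    cancel (suc m) p q {r} a≡ b≡ refl refl = ℤ.*-cancelˡ-≡ (+ suc m) p q
      (∙-cancelʳ ℤ.+-0-abelianGroup r _ _ (trans (sym a≡) b≡))

    e₁ : powerSum 1 A ≡ powerSum 1 B
    e₁ = cancel 2 (powerSum 1 A) (powerSum 1 B)
      (powerSum₁-double-centre k A) (powerSum₁-double-centre k B) e₁′ refl

    e₂ : powerSum 2 A ≡ powerSum 2 B
    e₂ = cancel 4 (powerSum 2 A) (powerSum 2 B)
      (powerSum₂-double-centre k A) (powerSum₂-double-centre k B) e₂′ (cong r₂ e₁)

    e₃ : powerSum 3 A ≡ powerSum 3 B
    e₃ = cancel 8 (powerSum 3 A) (powerSum 3 B)
      (powerSum₃-double-centre k A) (powerSum₃-double-centre k B) e₃′ (cong₂ r₃ e₁ e₂)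

-- The odd power sums vanish on both sides, and those of degree two are twice the sums of squares,
-- so cancelling 2 decides the matter.
IsIdealPTE₃-plusMinus : ∀ x y u v →
  IsIdealPTE₃ (plusMinus x y) (plusMinus u v) ⇔ (x ^ 2 + y ^ 2 ≡ u ^ 2 + v ^ 2)
IsIdealPTE₃-plusMinus x y u v = mk⇔
  (λ (_ , e₂ , _) → ℤ.*-cancelˡ-≡ (+ 2) (x ^ 2 + y ^ 2) (u ^ 2 + v ^ 2)
    (trans (sym (powerSum₂-plusMinus x y)) (trans e₂ (powerSum₂-plusMinus u v))))
  (λ e →
      trans (powerSum₁-plusMinus x y) (sym (powerSum₁-plusMinus u v))
    , trans (powerSum₂-plusMinus x y) (trans (cong (+ 2 *_) e) (sym (powerSum₂-plusMinus u v)))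
    , trans (powerSum₃-plusMinus x y) (sym (powerSum₃-plusMinus u v)))
  ⇔-∘ IsIdealPTE₃⇔ (plusMinus x y) (plusMinus u v)

coordinates⇒PTE⇔squares : ∀ A B c → IsHalfInteger c → ∀ x y u v → HasCoordinates A B c x y u v →
  IsIdealPTE₃ A B ⇔ (x ^ 2 + y ^ 2 ≡ u ^ 2 + v ^ 2)
coordinates⇒PTE⇔squares A B _ (k , refl) x y u v coords =
  -- Read from the right: rescale to 2a - k, permute into the form {±x, ±y}, {±u, ±v}, then compare
  -- squares.
  IsIdealPTE₃-plusMinus x y u v ⇔-∘
  (mk⇔ (IsIdealPTE₃-resp-≈ₘ p q) (IsIdealPTE₃-resp-≈ₘ (↭-sym p) (↭-sym q)) ⇔-∘
   IsIdealPTE₃-double-centre k A B)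
  where
  open HasCoordinates coords

  p : map (double-centre k) A ≈ₘ plusMinus x y
  p = fromℤ-cancel-≈ₘ (subst (_≈ₘ map fromℤ (plusMinus x y)) (doubled-⊖ k A) coordinatesˡ)

  q : map (double-centre k) B ≈ₘ plusMinus u v
  q = fromℤ-cancel-≈ₘ (subst (_≈ₘ map fromℤ (plusMinus u v)) (doubled-⊖ k B) coordinatesʳ)

proposition2p3 : (∀ (A B : Multiset ℤ 4) (c : ℚ) → IsSymmetricWithCenter A B c →
    ∃[ x ] ∃[ y ] ∃[ u ] ∃[ v ] HasCoordinates A B c x y u v)
    ×
    (∀ (A B : Multiset ℤ 4) (c : ℚ) → IsHalfInteger c →
    ∀ (x y u v : ℤ) → HasCoordinates A B c x y u v →
    (IsIdealPTE₃ A B ⇔ (x ^ 2 + y ^ 2 ≡ u ^ 2 + v ^ 2)))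
proposition2p3 = symmetric⇒coordinates , coordinates⇒PTE⇔squares
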